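{- Let $E^{\mathrm{ce}}$ be an equivalence relation on $\omega$ extending $=^{\mathrm{ce}}$. If $E^{\mathrm{ce}}<_{\mathrm{Learn}}\mathrm{Id}_1$ (equivalently, if $E^{\mathrm{ce}}$ is not universal), then there is an order embedding $$\iota\colon(\mathcal{P}_{\mathrm{fin}}(2^{\omega}),\subseteq)\to(\mathcal{E}^{\mathrm{ce}},\leq)$$ such that: (i) $\iota(\emptyset)=[E^{\mathrm{ce}}]_{\equiv_{\mathrm{Learn}}}$; (ii) for every $P\in\mathcal{P}_{\mathrm{fin}}(2^{\omega})$, we have $\iota(P)<[\mathrm{Id}_1]_{\equiv_{\mathrm{Learn}}}$. In particular, $\mathsf{TLH}=(\mathcal{E}^{\mathrm{ce}},\leq)$ is coatomless.
   Context: Fix a standard (acceptable) enumeration $(\varphi_e)_{e\in\omega}$ of the partial computable functions and let $W_e=\operatorname{dom}(\varphi_e)$. Write $e=^{\mathrm{ce}}e'$ iff $W_e=W_{e'}$. Let $\mathcal{R}^{\mathrm{ce}}$ be the set of all equivalence relations on $\omega$ extending $=^{\mathrm{ce}}$ (no definability or effectivity is assumed). $\mathrm{Id}_1$ is the one-class equivalence relation on $\omega$. An enumeration of a set $A$ is a surjection $\mu:\omega\to A$; $\mu[s]$ denotes the finite string $\mu(0),\dots,\mu(s-1)$. A learner is an arbitrary function $\mathbf{M}:\omega^{<\omega}\to\omega$ (no effectivity is assumed). For $E^{\mathrm{ce}}\in\mathcal{R}^{\mathrm{ce}}$, a family $\mathfrak{K}$ of nonempty c.e. sets is $E^{\mathrm{ce}}$-learnable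 if there is a learner $\mathbf{M}$ such that for every $e$ with $W_e\in\mathfrak{K}$ and every enumeration $\mu$ of $W_e$ there is $i\in\omega$ with $i\mathrel{E^{\mathrm{ce}}}e$ and $\mathbf{M}(\mu[s])=i$ for all sufficiently large $s$. $E^{\mathrm{ce}}$ is universal if every family of nonempty c.e. sets is $E^{\mathrm{ce}}$-learnable. $E^{\mathrm{ce}}\leq_{\mathrm{Learn}}F^{\mathrm{ce}}$ means that every $E^{\mathrm{ce}}$-learnable family of nonempty c.e. sets is also $F^{\mathrm{ce}}$-learnable; $<_{\mathrm{Learn}}$ is the strict part of this preorder and $\equiv_{\mathrm{Learn}}$ is mutual reducibility. The tolerant learning hierarchy $\mathsf{TLH}$ is the poset $(\mathcal{E}^{\mathrm{ce}},\leq)$ where $\mathcal{E}^{\mathrm{ce}}=\mathcal{R}^{\mathrm{ce}}/{\equiv_{\mathrm{Learn}}}$ and $\leq$ is induced by $\leq_{\mathrm{Learn}}$; its top element is $[\mathrm{Id}_1]_{\equiv_{\mathrm{Learn}}}$. $\mathcal{P}_{\mathrm{fin}}(X)$ is the set of all finite subsets of $X$. In a poset with top $\top$, a coatom is an element $a<\top$ such that there is no $b$ with $a<b<\top$; the poset is coatomless if it has no coatoms. -}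

module Defs where

open import Axiom.ExcludedMiddle using (ExcludedMiddle)
open import Data.Bool.Base using (Bool)
open import Data.Fin.Base using (Fin)
open import Data.List.Base using (List; applyUpTo)
import Data.List.Relation.Binary.Subset.Setoid as ListSubset
import Data.List.Relation.Binary.Subset.Setoid.Properties as ListSubsetₚ
open import Data.Nat.Base using (ℕ; zero; suc; _≤_; _<_)
open import Data.Product.Base using (Σ-syntax; ∃-syntax; _×_; _,_)
open import Data.Unit.Base using (⊤; tt)
open import Data.Vec.Base using (Vec; []; _∷_; lookup)
open import Data.Vec.Relation.Binary.Pointwise.Inductive using (Pointwise)
open import Function.Bundles using (_⇔_)
open import Level using (Setω; 0ℓ; _⊔_) renaming (suc to lsuc)
open import Relation.Binary.Bundles using (Poset; Setoid)
import Relation.Binary.Construct.Interior.Symmetric as Sym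
open import Relation.Binary.Core using (Rel; REL)
open import Relation.Binary.Definitions using (Maximum)
import Relation.Binary.Properties.Poset as Posetₚ
open import Relation.Binary.PropositionalEquality using (_≡_; refl; _→-setoid_)
open import Relation.Binary.Structures using (IsEquivalence)
open import Relation.Nullary.Negation.Core using (¬_)
open import Relation.Unary using (Pred; _∈_; _≐_; Satisfiable)

-- The mathematics is classical (ZFC).  As 'Dec P' carries a witness of P when
-- P holds, this also yields every instance of choice.
Classical : Setω
Classical = ∀ {ℓ} → ExcludedMiddle ℓ

------------------------------------------------------------------------
-- Partial recursive functions

data Rec : ℕ → Set where
  Z    : Rec 0
  S    : Rec 1
  proj : ∀ {n} → Fin n → Rec n
  comp : ∀ {m n} → Rec m → Vec (Rec n) m → Rec n
  prec : ∀ {n} → Rec n → Rec (suc (suc n)) → Rec (suc n)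
  mu   : ∀ {n} → Rec (suc n) → Rec n

infix 4 _[_]⇓_

data _[_]⇓_ : ∀ {n} → Rec n → Vec ℕ n → ℕ → Set where
  ⇓Z    : Z [ [] ]⇓ 0
  ⇓S    : ∀ {x} → S [ x ∷ [] ]⇓ suc x
  ⇓proj : ∀ {n} {i : Fin n} {xs} → proj i [ xs ]⇓ lookup xs i
  ⇓comp : ∀ {m n} {g : Rec m} {hs : Vec (Rec n) m} {xs ys z} →
          Pointwise (λ h y → h [ xs ]⇓ y) hs ys → g [ ys ]⇓ z →
          comp g hs [ xs ]⇓ z
  ⇓pz   : ∀ {n} {g : Rec n} {h xs y} →
          g [ xs ]⇓ y → prec g h [ zero ∷ xs ]⇓ y
  ⇓ps   : ∀ {n} {g : Rec n} {h k xs r y} →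
          prec g h [ k ∷ xs ]⇓ r → h [ k ∷ r ∷ xs ]⇓ y →
          prec g h [ suc k ∷ xs ]⇓ y
  ⇓mu   : ∀ {n} {f : Rec (suc n)} {xs y} →
          f [ y ∷ xs ]⇓ 0 →
          (∀ z → z < y → ∃[ w ] f [ z ∷ xs ]⇓ suc w) →
          mu f [ xs ]⇓ y

-- Partial functions are given by their graphs; single-valuedness of a
-- partial computable graph follows from determinism of evaluation.
PartialComputable₁ : (ℕ → ℕ → Set) → Set
PartialComputable₁ f = Σ[ p ∈ Rec 1 ] (∀ x y → f x y ⇔ p [ x ∷ [] ]⇓ y)

PartialComputable₂ : (ℕ → ℕ → ℕ → Set) → Set
PartialComputable₂ f =
  Σ[ p ∈ Rec 2 ] (∀ x₁ x₂ y → f x₁ x₂ y ⇔ p [ x₁ ∷ x₂ ∷ [] ]⇓ y)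

-- Acceptability in Rogers' sense: enumeration theorem and s-m-n theorem.
record AcceptableEnumeration : Set₁ where
  field
    φ          : ℕ → ℕ → ℕ → Set
    universal  : PartialComputable₂ φ
    surjective : ∀ f → PartialComputable₁ f →
                 ∃[ e ] (∀ x y → φ e x y ⇔ f x y)
    smn        : ∀ ψ → PartialComputable₂ ψ →
                 Σ[ s ∈ (ℕ → ℕ) ] PartialComputable₁ (λ x y → s x ≡ y) ×
                   (∀ e x y → φ (s e) x y ⇔ ψ e x y)

------------------------------------------------------------------------
-- Order theory

module _ {c ℓ₁ ℓ₂} (P : Poset c ℓ₁ ℓ₂) where
  open Poset P using (Carrier) renaming (_≤_ to _≤ᴾ_)
  open Posetₚ P using () renaming (_<_ to _<ᴾ_)

  module _ (top : Carrier) (_ : Maximum _≤ᴾ_ top) where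

    IsCoatom : Pred Carrier (c ⊔ ℓ₁ ⊔ ℓ₂)
    IsCoatom a = (a <ᴾ top) × ¬ (∃[ b ] (a <ᴾ b) × (b <ᴾ top))

    Coatomless : Set (c ⊔ ℓ₁ ⊔ ℓ₂)
    Coatomless = ¬ (∃[ a ] IsCoatom a)

-- Finite subsets of a setoid are lists, identified when they have the same
-- elements (order and repetitions are irrelevant).
𝒫fin : ∀ {c ℓ} → Setoid c ℓ → Poset c (c ⊔ ℓ) (c ⊔ ℓ)
𝒫fin A = Sym.poset {R = ListSubset._⊆_ A}
  (λ {xs} → ListSubsetₚ.⊆-refl A {xs})
  (λ {xs} {ys} {zs} → ListSubsetₚ.⊆-trans A {xs} {ys} {zs})

-- Binary sequences are equal when pointwise equal.
2^ω : Setoid 0ℓ 0ℓ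
2^ω = ℕ →-setoid Bool

------------------------------------------------------------------------
-- Learning, relative to an acceptable enumeration

module Learning (Φ : AcceptableEnumeration) where
  open AcceptableEnumeration Φ using (φ)

  W : ℕ → Pred ℕ 0ℓ
  W e x = ∃[ y ] φ e x y

  _=ᶜᵉ_ : Rel ℕ 0ℓ
  e =ᶜᵉ e′ = W e ≐ W e′

  record Rᶜᵉ : Set₁ where
    field
      _∼_           : Rel ℕ 0ℓ
      isEquivalence : IsEquivalence _∼_
      extends       : ∀ {e e′} → e =ᶜᵉ e′ → e ∼ e′

  Id₁ : Rᶜᵉ
  Id₁ = record
    { _∼_           = λ _ _ → ⊤
    ; isEquivalence = record
      { refl = tt ; sym = λ _ → tt ; trans = λ _ _ → tt }
    ; extends       = λ _ → tt
    }

  IsCE : Pred (Pred ℕ 0ℓ) 0ℓ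
  IsCE A = ∃[ e ] A ≐ W e

  -- 'resp' makes a family depend only on the extension of its members.
  record Family : Set₁ where
    field
      Member   : Pred (Pred ℕ 0ℓ) 0ℓ
      resp     : ∀ {A B} → A ≐ B → Member A → Member B
      ce       : ∀ {A} → Member A → IsCE A
      nonempty : ∀ {A} → Member A → Satisfiable A

  Enumerates : (ℕ → ℕ) → Pred ℕ 0ℓ → Set
  Enumerates μ A = (λ x → ∃[ n ] μ n ≡ x) ≐ A

  Learner : Set
  Learner = List ℕ → ℕ

  Learnable : Rᶜᵉ → Family → Set
  Learnable E 𝔎 =
    Σ[ M ∈ Learner ] (∀ e → W e ∈ Family.Member 𝔎 →
      ∀ μ → Enumerates μ (W e) →
      ∃[ i ] (i ∼ e × ∃[ s₀ ] (∀ s → s₀ ≤ s → M (applyUpTo μ s) ≡ i)))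
    where open Rᶜᵉ E

  Universal : Rᶜᵉ → Set₁
  Universal E = ∀ 𝔎 → Learnable E 𝔎

  infix 4 _≤Learn_ _<Learn_

  -- A record, so that E and F can be inferred from a proof of E ≤Learn F.
  record _≤Learn_ (E F : Rᶜᵉ) : Set₁ where
    constructor ≤learn
    field
      transfer : ∀ 𝔎 → Learnable E 𝔎 → Learnable F 𝔎

  _<Learn_ : Rel Rᶜᵉ (lsuc 0ℓ)
  E <Learn F = (E ≤Learn F) × ¬ (F ≤Learn E)

  -- The quotient of Rᶜᵉ by mutual reducibility is the setoid equality of
  -- this poset, so that E : Rᶜᵉ stands for its class.
  TLH : Poset (lsuc 0ℓ) (lsuc 0ℓ) (lsuc 0ℓ)
  TLH = Sym.poset {R = _≤Learn_}
    (≤learn (λ _ l → l))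
    (λ { (≤learn f) (≤learn g) → ≤learn (λ 𝔎 l → g 𝔎 (f 𝔎 l)) })

  Id₁-maximum : Maximum _≤Learn_ Id₁
  Id₁-maximum E = ≤learn λ 𝔎 _ →
    (λ _ → 0) , λ e _ μ _ → 0 , tt , 0 , λ _ _ → refl

{-# OPTIONS --safe #-}
module Submission where

-- A family is E-learnable iff each member c has a tell-tale: a finite D ⊆ c
-- such that all members between D and c are E-equivalent to c.  If E is not
-- universal, then some c.e. set a is the union of a strictly increasing chain
-- of finite sets D₀ ⊂ D₁ ⊂ … that are not E-equivalent to a.  For I ⊆ ℕ let
-- merge I move the sets Dₙ (n ∈ I), and nothing else, into the class of a.
-- This does not coarsen E, but an infinite c ≁ a is not a limit of the Dₙ, so
-- tell-tales survive the passage from merge I to merge J for I ⊆ J.  If J ∖ I is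
-- infinite, then {a} ∪ {Dₙ : n ∈ J} is learnable for merge J but not for
-- merge I.  Hence P ↦ merge (⋃ {branch X : X ∈ P}) is the embedding, where
-- the sets branch X are almost disjoint; no merge I so obtained is universal
-- since some X lies outside the finite set P.

open import Axiom.ExcludedMiddle using (ExcludedMiddle)
open import Data.Bool.Base using (Bool; true; false; not; if_then_else_)
open import Data.Bool.Properties using (not-¬)
open import Data.Empty using (⊥)
open import Data.Fin.Base using (zero; suc)
open import Data.List.Base using (List; []; _∷_; _++_; map; length; applyUpTo; filter)
open import Data.List.Membership.Propositional using () renaming (_∈_ to _∈ˡ_; _∉_ to _∉ˡ_)
open import Data.List.Membership.Propositional.Properties
  using (∈-++⁺ˡ; ∈-++⁺ʳ; ∈-applyUpTo⁺; ∈-applyUpTo⁻; ∈-filter⁺; ∈-filter⁻)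
open import Data.List.Properties using (++-assoc; ++-identityʳ; length-++; length-map)
open import Data.List.Relation.Binary.Subset.Propositional using () renaming (_⊆_ to _⊆ˡ_)
open import Data.List.Relation.Unary.All as All using (All; []; _∷_)
import Data.List.Relation.Unary.All.Properties as All
open import Data.List.Relation.Unary.Any as Any using (Any; here; there)
import Data.List.Relation.Unary.Any.Properties as Any
open import Data.Nat.Base as ℕ hiding (_<_)
open import Data.Nat.Binary.Base using (ℕᵇ; zero; 2[1+_]; 1+[2_]; toℕ)
open import Data.Nat.Binary.Properties using (toℕ-injective; 2[1+_]-injective; 1+[2_]-injective)
open import Data.Nat.Properties
open import Data.Product.Base using (Σ-syntax; ∃; ∃-syntax; _×_; _,_; proj₁; proj₂; map₂)
open import Data.Sum.Base using (_⊎_; inj₁; inj₂; [_,_]′)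
open import Data.Vec.Base as Vec using (Vec)
open import Data.Vec.Relation.Binary.Pointwise.Inductive using (Pointwise; []; _∷_)
open import Defs
open import Data.List.Membership.Setoid 2^ω using () renaming (_∈_ to _∈²_; _∉_ to _∉²_)
open import Function.Base using (_∘_; id; const; case_of_)
open import Function.Bundles using (_⇔_; mk⇔; module Equivalence)
open import Level using (0ℓ)
open import Relation.Binary.Bundles using (Poset)
open import Relation.Binary.Construct.Interior.Symmetric using (_,_; lhs≤rhs; rhs≤lhs)
open import Relation.Binary.Definitions using (tri<; tri≈; tri>)
open import Relation.Binary.Morphism.Structures using (IsOrderMonomorphism)
open import Relation.Binary.Properties.Poset using (_<_)
open import Relation.Binary.PropositionalEquality
  using (_≡_; _≢_; _≗_; refl; sym; trans; cong; cong₂; subst)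
open import Relation.Binary.Structures using (IsEquivalence)
open import Relation.Nullary.Decidable.Core using (yes; no; decidable-stable)
open import Relation.Nullary.Negation.Core using (¬_; contradiction)
open import Relation.Unary using (Pred; _⊆_; _≐_; Satisfiable)

-- Finite sets are computably enumerable

mutual
  ⇓-deterministic : ∀ {n} {f : Rec n} {xs y z} → f [ xs ]⇓ y → f [ xs ]⇓ z → y ≡ z
  ⇓-deterministic ⇓Z ⇓Z = refl
  ⇓-deterministic ⇓S ⇓S = refl
  ⇓-deterministic ⇓proj ⇓proj = refl
  ⇓-deterministic (⇓comp ps p) (⇓comp qs q) with refl ← ⇓-deterministic* ps qs = ⇓-deterministic p q
  ⇓-deterministic (⇓pz p) (⇓pz q) = ⇓-deterministic p q
  ⇓-deterministic (⇓ps p p′) (⇓ps q q′) with refl ← ⇓-deterministic p q = ⇓-deterministic p′ q′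
  -- If two searches ended at different points, the later one would have met a positive value where
  -- the earlier one found 0.
  ⇓-deterministic (⇓mu {y = y} p p<) (⇓mu {y = z} q q<) with <-cmp y z
  ... | tri≈ _ y≡z _ = y≡z
  ... | tri< y<z _ _ = contradiction (⇓-deterministic p (proj₂ (q< y y<z))) λ ()
  ... | tri> _ _ z<y = contradiction (⇓-deterministic q (proj₂ (p< z z<y))) λ ()

  ⇓-deterministic* : ∀ {m n} {fs : Vec (Rec n) m} {xs ys zs} →
    Pointwise (λ f y → f [ xs ]⇓ y) fs ys → Pointwise (λ f z → f [ xs ]⇓ z) fs zs → ys ≡ zs
  ⇓-deterministic* [] [] = refl
  ⇓-deterministic* (p ∷ ps) (q ∷ qs) = cong₂ Vec._∷_ (⇓-deterministic p q) (⇓-deterministic* ps qs)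

-- The tests below return 0 for "yes" and a positive value for "no".

equals : ℕ → Rec 1
equals zero    = proj zero
equals (suc a) = prec (comp S (Z Vec.∷ Vec.[])) (comp (equals a) (proj zero Vec.∷ Vec.[]))

equals-⇓ : ∀ a x → ∃[ v ] equals a [ x Vec.∷ Vec.[] ]⇓ v × (v ≡ 0 ⇔ x ≡ a)
equals-⇓ zero x = x , ⇓proj , mk⇔ id id
equals-⇓ (suc a) zero = 1 , ⇓pz (⇓comp (⇓Z ∷ []) ⇓S) , mk⇔ (λ ()) (λ ())
equals-⇓ (suc a) (suc x) =
  -- The step function ignores the recursive value, but `⇓ps` still demands that it be computed.
  let _ , p , _ = equals-⇓ (suc a) x
      v , q , v≡0⇔x≡a = equals-⇓ a x
  in v , ⇓ps p (⇓comp (⇓proj ∷ []) q) ,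
     mk⇔ (cong suc ∘ Equivalence.to v≡0⇔x≡a) (Equivalence.from v≡0⇔x≡a ∘ suc-injective)

-- Disjunction of tests: primitive recursion serves only to distinguish first argument zero from
-- positive.
ifZero : Rec 1 → Rec 2
ifZero f = prec (comp Z Vec.[]) (comp f (proj (suc (suc zero)) Vec.∷ Vec.[]))

ifZero-⇓ : ∀ {f x v} → f [ x Vec.∷ Vec.[] ]⇓ v → ∀ k →
  ∃[ w ] ifZero f [ k Vec.∷ x Vec.∷ Vec.[] ]⇓ w × (w ≡ 0 ⇔ (k ≡ 0 ⊎ v ≡ 0))
ifZero-⇓ p zero = 0 , ⇓pz (⇓comp [] ⇓Z) , mk⇔ (const (inj₁ refl)) (const refl)
ifZero-⇓ {v = v} p (suc k) =
  v , ⇓ps (proj₁ (proj₂ (ifZero-⇓ p k))) (⇓comp (⇓proj ∷ []) p) ,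
  mk⇔ inj₂ λ { (inj₁ ()) ; (inj₂ v≡0) → v≡0 }

member : List ℕ → Rec 1
member []      = comp S (comp Z Vec.[] Vec.∷ Vec.[])
member (a ∷ D) = comp (ifZero (member D)) (equals a Vec.∷ proj zero Vec.∷ Vec.[])

member-⇓ : ∀ D x → ∃[ v ] member D [ x Vec.∷ Vec.[] ]⇓ v × (v ≡ 0 ⇔ x ∈ˡ D)
member-⇓ [] x = 1 , ⇓comp (⇓comp [] ⇓Z ∷ []) ⇓S , mk⇔ (λ ()) (λ ())
member-⇓ (a ∷ D) x =
  let u , p , u≡0⇔x≡a = equals-⇓ a x
      v , q , v≡0⇔x∈D = member-⇓ D x
      w , r , w≡0⇔    = ifZero-⇓ q u
  in w , ⇓comp (p ∷ ⇓proj ∷ []) r ,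
     mk⇔ ([ here ∘ Equivalence.to u≡0⇔x≡a , there ∘ Equivalence.to v≡0⇔x∈D ]′ ∘ Equivalence.to w≡0⇔)
         (Equivalence.from w≡0⇔ ∘
           λ { (here x≡a)  → inj₁ (Equivalence.from u≡0⇔x≡a x≡a)
             ; (there x∈D) → inj₂ (Equivalence.from v≡0⇔x∈D x∈D) })

-- The test ignores the variable of the search, so the search stops at 0 if `x` passes and diverges
-- otherwise.
domain : List ℕ → Rec 1
domain D = mu (comp (member D) (proj (suc zero) Vec.∷ Vec.[]))

domain-⇓ : ∀ D x → ∃ (domain D [ x Vec.∷ Vec.[] ]⇓_) ⇔ x ∈ˡ D
domain-⇓ D x with v , p , v≡0⇔x∈D ← member-⇓ D x = mk⇔
  (λ { (_ , ⇓mu (⇓comp (⇓proj ∷ []) q) _) → Equivalence.to v≡0⇔x∈D (⇓-deterministic p q) })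
  (λ x∈D → 0 , ⇓mu (⇓comp (⇓proj ∷ []) (subst (member D [ _ ]⇓_) (Equivalence.from v≡0⇔x∈D x∈D) p))
                   λ _ ())

-- Sequences and their initial segments

prepend : List ℕ → (ℕ → ℕ) → ℕ → ℕ
prepend []       f n       = f n
prepend (x ∷ xs) f zero    = x
prepend (x ∷ xs) f (suc n) = prepend xs f n

applyUpTo-prepend : ∀ xs f n → applyUpTo (prepend xs f) (length xs + n) ≡ xs ++ applyUpTo f n
applyUpTo-prepend []       f n = refl
applyUpTo-prepend (x ∷ xs) f n = cong (x ∷_) (applyUpTo-prepend xs f n)

prepend-++ : ∀ xs ys f {n} → n ℕ.< length xs → prepend (xs ++ ys) f n ≡ prepend xs f n
prepend-++ (x ∷ xs) ys f {zero}  _         = refl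
prepend-++ (x ∷ xs) ys f {suc n} (s≤s n<l) = prepend-++ xs ys f n<l

prepend-All : ∀ {P : Pred ℕ 0ℓ} {xs f} → All P xs → (∀ n → P (f n)) → ∀ n → P (prepend xs f n)
prepend-All []         Pf n       = Pf n
prepend-All (px ∷ pxs) Pf zero    = px
prepend-All (px ∷ pxs) Pf (suc n) = prepend-All pxs Pf n

prepend-hits : ∀ xs f n → prepend xs f (length xs + n) ≡ f n
prepend-hits []       f n = refl
prepend-hits (x ∷ xs) f n = prepend-hits xs f n

applyUpTo-agree : ∀ xs {f g} → (∀ {n} → n ℕ.< length xs → f n ≡ prepend xs g n) →
  applyUpTo f (length xs) ≡ xs
applyUpTo-agree []       f≗ = refl
applyUpTo-agree (x ∷ xs) {g = g} f≗ = cong₂ _∷_ (f≗ z<s) (applyUpTo-agree xs {g = g} (f≗ ∘ s<s))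

module Limit (σ : ℕ → List ℕ) (x : ℕ → ℕ) (τ : ℕ → List ℕ)
             (σ-suc : ∀ k → σ (suc k) ≡ σ k ++ x k ∷ τ k) where

  -- By `length-σ`, position `n` lies inside `σ (suc n)`, so the default value 0 is never read.
  limit : ℕ → ℕ
  limit n = prepend (σ (suc n)) (const 0) n

  length-σ : ∀ k → k ≤ length (σ k)
  length-σ zero    = z≤n
  length-σ (suc k) rewrite σ-suc k | length-++ (σ k) {x k ∷ τ k} | +-suc (length (σ k)) (length (τ k)) =
    s≤s (≤-trans (length-σ k) (m≤m+n _ _))

  σ-extends : ∀ {j k} → j ≤′ k → ∃[ ρ ] σ k ≡ σ j ++ ρ
  σ-extends ≤′-refl = [] , sym (++-identityʳ _)
  σ-extends {j} {suc k} (≤′-step j≤k) with ρ , eq ← σ-extends j≤k =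
    ρ ++ x k ∷ τ k , trans (σ-suc k) (trans (cong (_++ _) eq) (++-assoc (σ j) ρ _))

  limit-prepend : ∀ k {n} → n ℕ.< length (σ k) → limit n ≡ prepend (σ k) (const 0) n
  limit-prepend k {n} n<l with ≤-total (suc n) k
  ... | inj₁ n<k with ρ , eq ← σ-extends (≤⇒≤′ n<k) rewrite eq =
    sym (prepend-++ (σ (suc n)) ρ _ (length-σ (suc n)))
  ... | inj₂ k≤n with ρ , eq ← σ-extends (≤⇒≤′ k≤n) rewrite eq = prepend-++ (σ k) ρ _ n<l

  applyUpTo-limit : ∀ k → applyUpTo limit (length (σ k)) ≡ σ k
  applyUpTo-limit k = applyUpTo-agree (σ k) (limit-prepend k)

  limit-hits : ∀ k → ∃[ n ] limit n ≡ x k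
  limit-hits k =
    let n , _ , eq = ∈-applyUpTo⁻ limit (subst (x k ∈ˡ_) (sym (applyUpTo-limit (suc k)))
                       (subst (x k ∈ˡ_) (sym (σ-suc k)) (∈-++⁺ʳ (σ k) (here refl))))
    in n , sym eq

  limit-All : ∀ {P : Pred ℕ 0ℓ} → (∀ k → All P (σ k)) → ∀ n → P (limit n)
  limit-All Pσ n = All.lookup (Pσ (suc n))
    (subst (limit n ∈ˡ_) (applyUpTo-limit (suc n)) (∈-applyUpTo⁺ limit (length-σ (suc n))))

-- Properties of all sufficiently large numbers

Eventually : Pred ℕ 0ℓ → Set
Eventually P = ∃[ s₀ ] ∀ s → s₀ ≤ s → P s

eventually-map : ∀ {P Q : Pred ℕ 0ℓ} → P ⊆ Q → Eventually P → Eventually Q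
eventually-map P⊆Q = map₂ λ p s s₀≤s → P⊆Q (p s s₀≤s)

eventually-× : ∀ {P Q : Pred ℕ 0ℓ} → Eventually P → Eventually Q → Eventually (λ s → P s × Q s)
eventually-× (m , p) (n , q) = m ⊔ n , λ s m⊔n≤s →
  p s (≤-trans (m≤m⊔n m n) m⊔n≤s) , q s (≤-trans (m≤n⊔m m n) m⊔n≤s)

eventually-All : ∀ {R : ℕ → Pred ℕ 0ℓ} {xs} → All (λ x → Eventually (R x)) xs →
  Eventually (λ s → All (λ x → R x s) xs)
eventually-All []       = 0 , λ _ _ → []
eventually-All (p ∷ ps) = eventually-map (λ (q , qs) → q ∷ qs) (eventually-× p (eventually-All ps))

eventually-∀< : ∀ {R : ℕ → Pred ℕ 0ℓ} n → (∀ m → m ℕ.< n → Eventually (R m)) →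
  Eventually (λ s → ∀ m → m ℕ.< n → R m s)
eventually-∀< zero    ev = 0 , λ _ _ _ ()
eventually-∀< {R} (suc n) ev = eventually-map
  (λ (below , at) m m<1+n → case m≤n⇒m<n∨m≡n (s≤s⁻¹ m<1+n) of
    λ { (inj₁ m<n) → below m m<n ; (inj₂ refl) → at })
  (eventually-× (eventually-∀< {R} n λ m m<n → ev m (m<n⇒m<1+n m<n)) (ev n ≤-refl))

-- An almost disjoint family of sets of natural numbers

-- Codes the string of the first `k` bits of `X` as a bijective base-2 numeral: the two nonzero
-- constructors of `ℕᵇ` act as digits, so distinct strings get distinct codes.
prefix : (ℕ → Bool) → ℕ → ℕᵇ
prefix X zero    = zero
prefix X (suc k) = if X k then 2[1+ prefix X k ] else 1+[2 prefix X k ]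

agree-suc : ∀ {X Y : ℕ → Bool} {k} → (∀ {i} → i ℕ.< k → X i ≡ Y i) → X k ≡ Y k →
  ∀ {i} → i ℕ.< suc k → X i ≡ Y i
agree-suc X≗Y Xk≡Yk i<1+k with m≤n⇒m<n∨m≡n (s≤s⁻¹ i<1+k)
... | inj₁ i<k  = X≗Y i<k
... | inj₂ refl = Xk≡Yk

prefix-injective : ∀ X Y j k → prefix X j ≡ prefix Y k → j ≡ k × (∀ {i} → i ℕ.< k → X i ≡ Y i)
prefix-injective X Y zero zero eq = refl , λ ()
prefix-injective X Y zero (suc k) eq with Y k
prefix-injective X Y zero (suc k) () | true
prefix-injective X Y zero (suc k) () | false
prefix-injective X Y (suc j) zero eq with X j
prefix-injective X Y (suc j) zero () | true
prefix-injective X Y (suc j) zero () | false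
prefix-injective X Y (suc j) (suc k) eq with X j in Xj | Y k in Yk
... | true | true with refl , X≗Y ← prefix-injective X Y j k (2[1+_]-injective eq) =
  refl , agree-suc X≗Y (trans Xj (sym Yk))
... | false | false with refl , X≗Y ← prefix-injective X Y j k (1+[2_]-injective eq) =
  refl , agree-suc X≗Y (trans Xj (sym Yk))

prefix-cong : ∀ {X Y} → X ≗ Y → ∀ k → prefix X k ≡ prefix Y k
prefix-cong X≗Y zero    = refl
prefix-cong X≗Y (suc k) rewrite X≗Y k | prefix-cong X≗Y k = refl

-- Each digit raises the value by at least one; this makes every branch unbounded.
k≤prefix : ∀ X k → k ≤ toℕ (prefix X k)
k≤prefix X zero    = z≤n
k≤prefix X (suc k) with X k
... | true  = ≤-trans (s≤s (k≤prefix X k)) (m≤m+n _ _)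
... | false = s≤s (≤-trans (k≤prefix X k) (m≤m+n _ _))

-- The nodes of the full binary tree along the path `X`; different paths share only the nodes up to
-- where they split.
branch : (ℕ → Bool) → Pred ℕ 0ℓ
branch X n = ∃[ k ] toℕ (prefix X k) ≡ n

branches : List (ℕ → Bool) → Pred ℕ 0ℓ
branches P n = Any (λ X → branch X n) P

∈⇒branch⊆branches : ∀ {X P} → X ∈² P → branch X ⊆ branches P
∈⇒branch⊆branches X∈P (k , eq) =
  Any.map (λ X≗Y → k , trans (cong toℕ (sym (prefix-cong X≗Y k))) eq) X∈P

branches-mono : ∀ {P Q} → (∀ {X} → X ∈² P → X ∈² Q) → branches P ⊆ branches Q
branches-mono {X ∷ P} P⊆Q (here b)  = ∈⇒branch⊆branches (P⊆Q (here λ _ → refl)) b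
branches-mono {X ∷ P} P⊆Q (there b) = branches-mono (P⊆Q ∘ there) b

-- Cantor's diagonal: dropping the first bit of the remaining sequences moves the next diagonal
-- entry to position 0.
diagonal : List (ℕ → Bool) → ℕ → Bool
diagonal []      k       = false
diagonal (X ∷ P) zero    = not (X 0)
diagonal (X ∷ P) (suc k) = diagonal (map (_∘ suc) P) k

diagonal∉ : ∀ P → diagonal P ∉² P
diagonal∉ P = go P _ refl
  where
  -- The recursion is on the length, since `map (_∘ suc) P` is not a subterm of the list.
  go : ∀ P n → length P ≡ n → diagonal P ∉² P
  go (X ∷ P) _ _ (here eq) = not-¬ refl (sym (eq 0))
  go (X ∷ P) (suc n) len (there d∈P) =
    go (map (_∘ suc) P) n (trans (length-map (_∘ suc) P) (suc-injective len))
       (Any.map⁺ (Any.map (_∘ suc) d∈P))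

module Hierarchy (em : ExcludedMiddle 0ℓ) (Φ : AcceptableEnumeration) where
  open Learning Φ
  open AcceptableEnumeration Φ using (surjective)
  open Family using (Member)

  -- Classical principles and indices of finite sets

  dne : ∀ {P : Set} → ¬ ¬ P → P
  dne = decidable-stable em

  ¬⊆⇒∃ : ∀ (P Q : Pred ℕ 0ℓ) → ¬ (P ⊆ Q) → ∃[ x ] P x × ¬ Q x
  ¬⊆⇒∃ _ _ P⊈Q = dne λ none → P⊈Q λ Px → dne λ ¬Qx → none (_ , Px , ¬Qx)

  -- Beyond a position where `X` and `Y` differ, no prefix of `X` is one of `Y`; a finite list needs
  -- only the maximum of finitely many such bounds.
  almost-disjoint : ∀ {X} P → X ∉² P → Eventually (λ k → ¬ branches P (toℕ (prefix X k)))
  almost-disjoint [] X∉P = 0 , λ _ _ ()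
  almost-disjoint {X} (Y ∷ P) X∉P =
    let i , X≢Y = dne {∃[ i ] X i ≢ Y i} λ none → X∉P (here λ i → dne λ Xi≢Yi → none (i , Xi≢Yi))
        outside : Eventually (λ k → ¬ branch Y (toℕ (prefix X k)))
        outside = suc i , λ k i<k (j , eq) →
          X≢Y (sym (proj₂ (prefix-injective Y X j k (toℕ-injective eq)) i<k))
    in eventually-map (λ { (∉Y , ∉P) (here b) → ∉Y b ; (∉Y , ∉P) (there b) → ∉P b })
         (eventually-× outside (almost-disjoint P (X∉P ∘ there)))

  fin : List ℕ → ℕ
  fin D = proj₁ (surjective _ (domain D , λ _ _ → mk⇔ id id))

  W-fin : ∀ D → W (fin D) ≐ (_∈ˡ D)
  W-fin D =
    let _ , φ⇔ = surjective _ (domain D , λ _ _ → mk⇔ id id)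
    in (λ (y , p) → Equivalence.to (domain-⇓ D _) (y , Equivalence.to (φ⇔ _ y) p)) ,
       (λ x∈D → let y , p = Equivalence.from (domain-⇓ D _) x∈D in y , Equivalence.from (φ⇔ _ y) p)

  ∈-fin : ∀ {D D′} → (∀ {x} → x ∈ˡ D → x ∈ˡ D′) → All (W (fin D′)) D
  ∈-fin {D′ = D′} D⊆D′ = All.tabulate (proj₂ (W-fin D′) ∘ D⊆D′)

  fin⊆ : ∀ {c D} → All (W c) D → W (fin D) ⊆ W c
  fin⊆ {D = D} D⊆c = All.lookup D⊆c ∘ proj₁ (W-fin D)

  -- Learnability and tell-tales

  -- Angluin's tell-tale condition, with equality of sets relaxed to `E`.
  IsTelltale : Rᶜᵉ → Family → ℕ → Pred (List ℕ) 0ℓ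
  IsTelltale E 𝔎 c D = All (W c) D ×
    (∀ b → Member 𝔎 (W b) → All (W b) D → W b ⊆ W c → Rᶜᵉ._∼_ E b c)

  Telltales : Rᶜᵉ → Family → Set
  Telltales E 𝔎 = ∀ {c} → Member 𝔎 (W c) → ∃ (IsTelltale E 𝔎 c)

  Least : Pred ℕ 0ℓ → Pred ℕ 0ℓ
  Least P n = P n × (∀ {m} → m ℕ.< n → ¬ P m)

  least : ∀ {P} → ∃ P → ∃ (Least P)
  least {P} (n , Pn) = [ id , (λ none → contradiction Pn (none ≤-refl)) ]′ (search (suc n))
    where
    search : ∀ n → ∃ (Least P) ⊎ (∀ {m} → m ℕ.< n → ¬ P m)
    search zero = inj₂ λ ()
    search (suc n) with search n | em {P n}
    ... | inj₁ l    | _       = inj₁ l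
    ... | inj₂ none | yes Pn  = inj₁ (n , Pn , none)
    ... | inj₂ none | no  ¬Pn = inj₂ λ m<1+n → case m≤n⇒m<n∨m≡n (s≤s⁻¹ m<1+n) of
      λ { (inj₁ m<n) → none m<n ; (inj₂ refl) → ¬Pn }

  least-unique : ∀ {P m n} → Least P m → Least P n → m ≡ n
  least-unique {m = m} {n} (Pm , m-min) (Pn , n-min) with <-cmp m n
  ... | tri< m<n _ _ = contradiction Pm (n-min m<n)
  ... | tri≈ _ m≡n _ = m≡n
  ... | tri> _ _ n<m = contradiction Pn (m-min n<m)

  module _ (𝔎 : Family) {c : ℕ} (c∈𝔎 : Member 𝔎 (W c)) where

    enum : ℕ → ℕ
    enum n with em {W c n}
    ... | yes _ = n
    ... | no  _ = proj₁ (Family.nonempty 𝔎 c∈𝔎)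

    enum-∈ : ∀ n → W c (enum n)
    enum-∈ n with em {W c n}
    ... | yes n∈c = n∈c
    ... | no  _   = proj₂ (Family.nonempty 𝔎 c∈𝔎)

    enum-hits : ∀ {n} → W c n → enum n ≡ n
    enum-hits {n} n∈c with em {W c n}
    ... | yes _   = refl
    ... | no  n∉c = contradiction n∈c n∉c

    prepend-enumerates : ∀ {σ} → All (W c) σ → Enumerates (prepend σ enum) (W c)
    prepend-enumerates {σ} σ⊆c =
      (λ { (n , refl) → prepend-All σ⊆c enum-∈ n }) ,
      (λ n∈c → length σ + _ , trans (prepend-hits σ enum _) (enum-hits n∈c))

  module _ (E : Rᶜᵉ) (𝔎 : Family) where
    open Rᶜᵉ E

    ¬telltale⇒unstable : ∀ {c} → ¬ ∃ (IsTelltale E 𝔎 c) → ∀ {D} → All (W c) D →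
      ∃[ b ] Member 𝔎 (W b) × All (W b) D × W b ⊆ W c × ¬ b ∼ c
    ¬telltale⇒unstable none D⊆c = dne λ stable → none (_ , D⊆c , λ b b∈𝔎 D⊆b b⊆c →
      dne λ b≁c → stable (b , b∈𝔎 , D⊆b , b⊆c , b≁c))

    -- The learner conjectures the least index that is consistent with the data and whose tell-tale
    -- has appeared. On `c` it settles on the least `e` with `De ⊆ c ⊆ e`, and the tell-tale of `e`
    -- then gives `c ∼ e`.
    telltales⇒learnable : Telltales E 𝔎 → Learnable E 𝔎
    telltales⇒learnable T = M , converges
      where
      Candidate : List ℕ → Pred ℕ 0ℓ
      Candidate σ e = Σ[ e∈𝔎 ∈ Member 𝔎 (W e) ] All (_∈ˡ σ) (proj₁ (T e∈𝔎)) × All (W e) σ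

      M : Learner
      M σ with em {∃ (Least (Candidate σ))}
      ... | yes (e , _) = e
      ... | no  _       = 0

      M-least : ∀ {σ e} → Least (Candidate σ) e → M σ ≡ e
      M-least {σ} l with em {∃ (Least (Candidate σ))}
      ... | yes (_ , l′) = least-unique l′ l
      ... | no  none     = contradiction (_ , l) none

      converges : ∀ c → Member 𝔎 (W c) → ∀ μ → Enumerates μ (W c) →
        ∃[ i ] (i ∼ c × Eventually (λ s → M (applyUpTo μ s) ≡ i))
      converges c c∈𝔎 μ (μ⊆c , c⊆μ) =
        let e , (e∈𝔎 , De⊆c , c⊆e) , e-min = least {Limiting} (c , c∈𝔎 , proj₁ (proj₂ (T c∈𝔎)) , id)
            candidate = eventually-map
              (λ De⊆σ → e∈𝔎 , De⊆σ , All.applyUpTo⁺₂ μ _ (c⊆e ∘ μ∈c))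
              (eventually-All (All.map appears De⊆c))
            minimal = eventually-∀< {λ d s → ¬ Candidate (applyUpTo μ s) d} e
              λ d d<e → refuted (e-min d<e)
        in e , sym-∼ (proj₂ (proj₂ (T e∈𝔎)) c c∈𝔎 De⊆c c⊆e) ,
           eventually-map (λ (cand , min) → M-least (cand , λ {m} → min m)) (eventually-× candidate minimal)
        where
        sym-∼ : ∀ {i j} → i ∼ j → j ∼ i
        sym-∼ = IsEquivalence.sym isEquivalence

        μ∈c : ∀ n → W c (μ n)
        μ∈c n = μ⊆c (n , refl)

        appears : W c ⊆ λ x → Eventually (λ s → x ∈ˡ applyUpTo μ s)
        appears x∈c with n , refl ← c⊆μ x∈c = suc n , λ _ n<s → ∈-applyUpTo⁺ μ n<s

        Limiting : Pred ℕ 0ℓ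
        Limiting d = Σ[ d∈𝔎 ∈ Member 𝔎 (W d) ] All (W c) (proj₁ (T d∈𝔎)) × W c ⊆ W d

        -- Either some element of `c` outside `d` shows up, or `c ⊆ d` and a tell-tale of `d`
        -- contained in the data would make `d` limiting.
        refuted : ∀ {d} → ¬ Limiting d → Eventually (λ s → ¬ Candidate (applyUpTo μ s) d)
        refuted {d} ¬d with em {W c ⊆ W d}
        ... | yes c⊆d = 0 , λ _ _ (d∈𝔎 , D⊆σ , _) →
          ¬d (d∈𝔎 , All.map (All.lookup (All.applyUpTo⁺₂ μ _ μ∈c)) D⊆σ , c⊆d)
        ... | no  c⊈d = let x , x∈c , x∉d = ¬⊆⇒∃ (W c) (W d) c⊈d in
          eventually-map (λ x∈σ (_ , _ , σ⊆d) → x∉d (All.lookup σ⊆d x∈σ)) (appears x∈c)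

    -- Against a learner, a set without tell-tale is enumerated in blocks,
    -- after each of which the learner's conjecture is wrong.
    learnable⇒telltales : Learnable E 𝔎 → Telltales E 𝔎
    learnable⇒telltales (M , converges) {c} c∈𝔎 = dne λ none → Fooled.absurd (¬telltale⇒unstable none)
      where
      module Fooled (unstable : ∀ {D} → All (W c) D →
                       ∃[ b ] Member 𝔎 (W b) × All (W b) D × W b ⊆ W c × ¬ b ∼ c) where

        block : ∀ k {σ} → All (W c) σ →
          ∃[ τ ] All (W c) (enum 𝔎 c∈𝔎 k ∷ τ) × ¬ M (σ ++ enum 𝔎 c∈𝔎 k ∷ τ) ∼ c
        block k {σ} σ⊆c =
          -- Instability gives a member `b ≁ c` containing the data so far; following `b` until `M`
          -- settles forces a conjecture equivalent to `b`. Including `enum 𝔎 c∈𝔎 k` ensures that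
          -- all of `c` is listed in the limit.
          let ρ = σ ++ enum 𝔎 c∈𝔎 k ∷ []
              ρ⊆c = All.++⁺ σ⊆c (enum-∈ 𝔎 c∈𝔎 k ∷ [])
              b , b∈𝔎 , ρ⊆b , b⊆c , b≁c = unstable ρ⊆c
              f = enum 𝔎 b∈𝔎
              i , i∼b , s₀ , conv = converges b b∈𝔎 (prepend ρ f) (prepend-enumerates 𝔎 b∈𝔎 ρ⊆b)
              M≡i : M (σ ++ enum 𝔎 c∈𝔎 k ∷ applyUpTo f s₀) ≡ i
              M≡i = trans (cong M (trans (sym (++-assoc σ _ _)) (sym (applyUpTo-prepend ρ f s₀))))
                          (conv _ (m≤n+m s₀ (length ρ)))
          in applyUpTo f s₀ ,
             enum-∈ 𝔎 c∈𝔎 k ∷ All.applyUpTo⁺₂ f s₀ (b⊆c ∘ enum-∈ 𝔎 b∈𝔎) ,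
             λ M∼c → b≁c (IsEquivalence.trans isEquivalence (IsEquivalence.sym isEquivalence i∼b)
                            (subst (_∼ c) M≡i M∼c))

        stage : ℕ → ∃ (All (W c))
        stage zero    = [] , []
        stage (suc k) = let σ , σ⊆c = stage k ; τ , τ⊆c , _ = block k σ⊆c in
          σ ++ enum 𝔎 c∈𝔎 k ∷ τ , All.++⁺ σ⊆c τ⊆c

        open Limit (proj₁ ∘ stage) (enum 𝔎 c∈𝔎) (λ k → proj₁ (block k (proj₂ (stage k)))) (λ _ → refl)

        absurd : ⊥
        absurd =
          let i , i∼c , s₀ , conv = converges c c∈𝔎 limit
                ( (λ { (n , refl) → limit-All (proj₂ ∘ stage) n })
                , (λ x∈c → subst (λ y → ∃[ n ] limit n ≡ y) (enum-hits 𝔎 c∈𝔎 x∈c) (limit-hits _)))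
              -- Block `s₀` ends at stage `suc s₀`, whose length exceeds `s₀`, so `M` has already
              -- converged there.
              eq = conv (length (proj₁ (stage (suc s₀)))) (≤-trans (n≤1+n s₀) (length-σ (suc s₀)))
          in proj₂ (proj₂ (block s₀ (proj₂ (stage s₀))))
               (subst (_∼ c) (trans (sym eq) (cong M (applyUpTo-limit (suc s₀)))) i∼c)

  -- Non-universality is witnessed by finite sets

  module _ (E : Rᶜᵉ) where
    open Rᶜᵉ E

    FinUnstable : Pred ℕ 0ℓ
    FinUnstable a = ∀ {D} → All (W a) D → ∃[ D′ ] D ⊆ˡ D′ × All (W a) D′ × ¬ fin D′ ∼ a

    -- If all large enough finite subsets of c are equivalent to c, then any
    -- large enough b ⊆ c with b ≁ c serves as a, as its finite subsets are ∼ c.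
    unstable⇒finUnstable : ∀ {c x} → W c x →
      (∀ {D} → All (W c) D → ∃[ b ] All (W b) D × W b ⊆ W c × ¬ b ∼ c) →
      ∃[ a ] Satisfiable (W a) × FinUnstable a
    unstable⇒finUnstable {c} {x} x∈c unstable with em {FinUnstable c}
    ... | yes fu = c , (x , x∈c) , fu
    ... | no ¬fu =
      let D , D⊆c , stable = dne {∃[ D ] All (W c) D ×
              (∀ {D′} → D ⊆ˡ D′ → All (W c) D′ → fin D′ ∼ c)}
            λ none → ¬fu λ {D} D⊆c → dne λ none′ → none (D , D⊆c , λ {D′} D⊆D′ D′⊆c →
              dne λ D′≁c → none′ (D′ , D⊆D′ , D′⊆c , D′≁c))
          b , D⊆b , b⊆c , b≁c = unstable (x∈c ∷ D⊆c)
      in b , (x , All.head D⊆b) , λ {D₁} D₁⊆b →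
           let DD₁⊆b = All.++⁺ (All.tail D⊆b) D₁⊆b
           in D ++ D₁ , ∈-++⁺ʳ D , DD₁⊆b ,
              λ D′∼b → b≁c (IsEquivalence.trans isEquivalence (IsEquivalence.sym isEquivalence D′∼b)
                              (stable ∈-++⁺ˡ (All.map b⊆c DD₁⊆b)))

    -- Without such an `a` every member of every family would have a tell-tale, making every family
    -- learnable.
    ¬universal⇒finUnstable : ¬ Universal E → ∃[ a ] Satisfiable (W a) × FinUnstable a
    ¬universal⇒finUnstable ¬univ = dne λ none → ¬univ λ 𝔎 →
      telltales⇒learnable E 𝔎 λ c∈𝔎 → dne λ noTelltale →
        none (unstable⇒finUnstable (proj₂ (Family.nonempty 𝔎 c∈𝔎)) λ D⊆c →
          let b , _ , rest = ¬telltale⇒unstable E 𝔎 noTelltale D⊆c in b , rest)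

    -- `strict` keeps the sets `D n` distinct, so that they can be merged selectively; `inhabited`
    -- admits them to families of nonempty sets.
    record Exhaustion : Set where
      field
        a         : ℕ
        D         : ℕ → List ℕ
        D⊆a       : ∀ n → All (W a) (D n)
        mono      : ∀ {m n} → m ≤ n → D m ⊆ˡ D n
        strict    : ∀ {m n} → m ℕ.< n → ¬ D n ⊆ˡ D m
        exhausts  : ∀ {x} → W a x → ∃[ n ] x ∈ˡ D n
        separated : ∀ n → ¬ fin (D n) ∼ a
        inhabited : ∀ n → ∃[ x ] x ∈ˡ D n

    exhaustion : ¬ Universal E → Exhaustion
    exhaustion ¬univ with a , (x₀ , x₀∈a) , fu ← ¬universal⇒finUnstable ¬univ = record
      { a         = a
      ; D         = D
      ; D⊆a       = λ n → proj₁ (proj₂ (stage n))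
      ; mono      = mono ∘ ≤⇒≤′
      ; strict    = λ {m} m<n n⊆m → let _ , y∈ , y∉ = fresh m in y∉ (n⊆m (mono (≤⇒≤′ m<n) y∈))
      -- Step `x` of the construction adds `x` itself whenever it belongs to `a`.
      ; exhausts  = λ {x} x∈a → suc x , proj₂ (proj₂ (proj₂ (next x (stage x)))) x∈a
      ; separated = λ n → proj₁ (proj₂ (proj₂ (stage n)))
      ; inhabited = λ n → proj₂ (proj₂ (proj₂ (stage n)))
      }
      where
      Stage : Pred (List ℕ) 0ℓ
      Stage D = All (W a) D × ¬ fin D ∼ a × (∃[ x ] x ∈ˡ D)

      next : ∀ k (s : ∃ Stage) → Σ[ s′ ∈ ∃ Stage ]
        proj₁ s ⊆ˡ proj₁ s′ × (∃[ y ] y ∈ˡ proj₁ s′ × y ∉ˡ proj₁ s) × (W a k → k ∈ˡ proj₁ s′)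
      next k (D , D⊆a , D≁a , x , x∈D) =
        -- `D` cannot be all of `a`, since `extends` would then give `fin D ∼ a`; the new point `y`
        -- makes the chain strict.
        let y , y∈a , y∉D = ¬⊆⇒∃ (W a) (_∈ˡ D) λ a⊆D → D≁a (extends (fin⊆ D⊆a , proj₂ (W-fin D) ∘ a⊆D))
            ks , ks⊆a , k∈ks = singleton
            D′ , D⊆D′ , D′⊆a , D′≁a = fu (y∈a ∷ All.++⁺ ks⊆a D⊆a)
        in (D′ , D′⊆a , D′≁a , x , D⊆D′ (there (∈-++⁺ʳ ks x∈D))) ,
           D⊆D′ ∘ there ∘ ∈-++⁺ʳ ks , (y , D⊆D′ (here refl) , y∉D) ,
           D⊆D′ ∘ there ∘ ∈-++⁺ˡ ∘ k∈ks
        where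
        singleton : ∃[ ks ] All (W a) ks × (W a k → k ∈ˡ ks)
        singleton with em {W a k}
        ... | yes k∈a = k ∷ [] , k∈a ∷ [] , λ _ → here refl
        ... | no  k∉a = [] , [] , λ k∈a → contradiction k∈a k∉a

      stage : ℕ → ∃ Stage
      stage zero = let D , x₀∈D , D⊆a , D≁a = fu (x₀∈a ∷ []) in D , D⊆a , D≁a , x₀ , x₀∈D (here refl)
      stage (suc k) = proj₁ (next k (stage k))

      D : ℕ → List ℕ
      D = proj₁ ∘ stage

      fresh : ∀ k → ∃[ y ] y ∈ˡ D (suc k) × y ∉ˡ D k
      fresh k = proj₁ (proj₂ (proj₂ (next k (stage k))))

      mono : ∀ {m n} → m ≤′ n → D m ⊆ˡ D n
      mono ≤′-refl = id
      mono {m} {suc n} (≤′-step m≤n) = proj₁ (proj₂ (next n (stage n))) ∘ mono m≤n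

  -- Merging finite sets of the exhaustion with its limit

  module Merging (E : Rᶜᵉ) (X : Exhaustion E) where
    open Rᶜᵉ E
    open Exhaustion X
    open IsEquivalence isEquivalence
      renaming (refl to ∼-refl; sym to ∼-sym; trans to ∼-trans; reflexive to ∼-reflexive)

    -- Stated by extension, so that all indices of one set `D n` move together, as `extends`
    -- requires.
    Merged : Pred ℕ 0ℓ → Pred ℕ 0ℓ
    Merged I x = ∃[ n ] I n × W x ≐ (_∈ˡ D n)

    rep : Pred ℕ 0ℓ → ℕ → ℕ
    rep I x with em {Merged I x}
    ... | yes _ = a
    ... | no  _ = x

    rep-merged : ∀ {I x} → Merged I x → rep I x ≡ a
    rep-merged {I} {x} m with em {Merged I x}
    ... | yes _ = refl
    ... | no ¬m = contradiction m ¬m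

    rep-unmerged : ∀ {I x} → ¬ Merged I x → rep I x ≡ x
    rep-unmerged {I} {x} ¬m with em {Merged I x}
    ... | yes m = contradiction m ¬m
    ... | no  _ = refl

    merged-resp : ∀ {I x y} → x =ᶜᵉ y → Merged I x → Merged I y
    merged-resp (x⊆y , y⊆x) (n , n∈I , x⊆D , D⊆x) = n , n∈I , x⊆D ∘ y⊆x , x⊆y ∘ D⊆x

    rep-extends : ∀ {I x y} → x =ᶜᵉ y → rep I x ∼ rep I y
    rep-extends {I} {x} {y} x≐y@(x⊆y , y⊆x) with em {Merged I x} | em {Merged I y}
    ... | yes _ | yes _ = ∼-refl
    ... | yes m | no ¬m = contradiction (merged-resp x≐y m) ¬m
    ... | no ¬m | yes m = contradiction (merged-resp (y⊆x , x⊆y) m) ¬m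
    ... | no  _ | no  _ = extends x≐y

    -- The pullback of `E` along `rep I`: merged sets leave their old classes, whose other members
    -- stay behind.
    merge : Pred ℕ 0ℓ → Rᶜᵉ
    merge I = record
      { _∼_           = λ x y → rep I x ∼ rep I y
      ; isEquivalence = record { refl = ∼-refl ; sym = ∼-sym ; trans = ∼-trans }
      ; extends       = rep-extends
      }

    a-unmerged : ∀ {I} → ¬ Merged I a
    a-unmerged (n , _ , a⊆D , D⊆a) =
      separated n (extends (D⊆a ∘ proj₁ (W-fin (D n)) , proj₂ (W-fin (D n)) ∘ a⊆D))

    D-unmerged : ∀ {I n} → ¬ I n → ¬ Merged I (fin (D n))
    D-unmerged {I} {n} n∉I (m , m∈I , n⊆m , m⊆n) with <-cmp m n
    ... | tri< m<n _ _  = strict m<n (n⊆m ∘ proj₂ (W-fin (D n)))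
    ... | tri≈ _ refl _ = n∉I m∈I
    ... | tri> _ _ n<m  = strict n<m (proj₁ (W-fin (D n)) ∘ m⊆n)

    -- Tell-tales under further merging

    Finite : Pred ℕ 0ℓ
    Finite c = ∃[ L ] W c ≐ (_∈ˡ L)

    ⊆⇒finite : ∀ {c L} → W c ⊆ (_∈ˡ L) → Finite c
    ⊆⇒finite {c} {L} c⊆L = filter (λ x → em {W c x}) L ,
      (λ x∈c → ∈-filter⁺ _ (c⊆L x∈c) x∈c) , proj₂ ∘ ∈-filter⁻ _ {xs = L}

    -- Provides a point whose addition to a tell-tale of `c` keeps every `D n` from lying between
    -- the tell-tale and `c`.
    isolated : ∀ {c} → ¬ Finite c → ¬ c ∼ a →
      ∃[ y ] W c y × (∀ {n} → y ∈ˡ D n → ¬ ((_∈ˡ D n) ⊆ W c))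
    isolated {c} infinite c≁a with em {W c ⊆ W a}
    ... | no  c⊈a = let y , y∈c , y∉a = ¬⊆⇒∃ (W c) (W a) c⊈a in
      y , y∈c , λ {n} y∈D _ → y∉a (All.lookup (D⊆a n) y∈D)
    ... | yes c⊆a =
      -- From index `m` on, the sets `D n` contain `x ∉ c`; up to `m` they miss a point `y` of the
      -- infinite set `c` chosen outside `D m`.
      let x , x∈a , x∉c = ¬⊆⇒∃ (W a) (W c) λ a⊆c → c≁a (extends (c⊆a , a⊆c))
          m , x∈D = exhausts x∈a
          y , y∈c , y∉D = ¬⊆⇒∃ (W c) (_∈ˡ D m) (infinite ∘ ⊆⇒finite {L = D m})
      in y , y∈c , λ {n} y∈Dn Dn⊆c → case ≤-total n m of
           λ { (inj₁ n≤m) → y∉D (mono n≤m y∈Dn)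
             ; (inj₂ m≤n) → x∉c (Dn⊆c (mono m≤n x∈D)) }

    -- A finite `c` is its own tell-tale. An infinite `c ∼ a` keeps its tell-tale, as newly merged
    -- sets enter its class. For an infinite `c ≁ a`, the point from `isolated` excludes all sets
    -- whose class could change.
    merge-telltales : ∀ {I J} 𝔎 → I ⊆ J → Telltales (merge I) 𝔎 → Telltales (merge J) 𝔎
    merge-telltales {I} {J} 𝔎 I⊆J tell {c} c∈𝔎 with em {Finite c} | em {c ∼ a} | tell c∈𝔎
    ... | yes (L , c⊆L , L⊆c) | _ | _ = L , All.tabulate L⊆c ,
      λ b _ L⊆b b⊆c → rep-extends (b⊆c , All.lookup L⊆b ∘ c⊆L)
    ... | no infinite | yes c∼a | D₀ , D₀⊆c , close = D₀ , D₀⊆c , λ b b∈𝔎 D₀⊆b b⊆c →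
      subst (rep J b ∼_) (sym c-fixed) (lift (subst (rep I b ∼_) c-fixed (close b b∈𝔎 D₀⊆b b⊆c)))
      where
      c-fixed : ∀ {R} → rep R c ≡ c
      c-fixed = rep-unmerged λ (n , _ , c≐D) → infinite (D n , c≐D)

      lift : ∀ {b} → rep I b ∼ c → rep J b ∼ c
      lift {b} b∼c with em {Merged J b}
      ... | yes _ = ∼-sym c∼a
      ... | no ¬m = subst (_∼ c) (rep-unmerged λ (n , n∈I , b≐D) → ¬m (n , I⊆J n∈I , b≐D)) b∼c
    ... | no infinite | no c≁a | D₀ , D₀⊆c , close =
      let y , y∈c , isolates = isolated infinite c≁a
      in y ∷ D₀ , y∈c ∷ D₀⊆c , λ { b b∈𝔎 (y∈b ∷ D₀⊆b) b⊆c →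
           let b-fixed : ∀ {R} → rep R b ≡ b
               b-fixed = rep-unmerged λ (n , _ , b⊆D , D⊆b) → isolates (b⊆D y∈b) (b⊆c ∘ D⊆b)
               c-fixed : ∀ {R} → rep R c ≡ c
               c-fixed = rep-unmerged λ (n , _ , c≐D) → infinite (D n , c≐D)
           in subst (λ z → rep J b ∼ z) (trans (c-fixed {I}) (sym c-fixed))
                (subst (_∼ rep I c) (trans b-fixed (sym b-fixed)) (close b b∈𝔎 D₀⊆b b⊆c)) }

    merge-mono : ∀ {I J} → I ⊆ J → merge I ≤Learn merge J
    merge-mono {I} {J} I⊆J = ≤learn λ 𝔎 →
      telltales⇒learnable (merge J) 𝔎 ∘ merge-telltales 𝔎 I⊆J ∘ learnable⇒telltales (merge I) 𝔎

    -- Families of finite sets converging to `a`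

    converging : Pred ℕ 0ℓ → Family
    converging J = record
      { Member   = λ A → A ≐ W a ⊎ (∃[ n ] J n × A ≐ (_∈ˡ D n))
      ; resp     = λ { (A⊆B , B⊆A) (inj₁ (A⊆a , a⊆A)) → inj₁ (A⊆a ∘ B⊆A , A⊆B ∘ a⊆A)
                     ; (A⊆B , B⊆A) (inj₂ (n , n∈J , A⊆D , D⊆A)) →
                         inj₂ (n , n∈J , A⊆D ∘ B⊆A , A⊆B ∘ D⊆A) }
      ; ce       = λ { (inj₁ A≐a) → a , A≐a
                     ; (inj₂ (n , _ , A⊆D , D⊆A)) → fin (D n) ,
                         (proj₂ (W-fin (D n)) ∘ A⊆D) , (D⊆A ∘ proj₁ (W-fin (D n))) }
      ; nonempty = λ { (inj₁ (_ , a⊆A)) →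
                         let x , x∈D = inhabited 0 in x , a⊆A (All.lookup (D⊆a 0) x∈D)
                     ; (inj₂ (n , _ , _ , D⊆A)) → let x , x∈D = inhabited n in x , D⊆A x∈D }
      }

    -- All members are equivalent to `a`, so the empty tell-tale works.
    converging-learnable : ∀ {I J} → J ⊆ I → Learnable (merge I) (converging J)
    converging-learnable {I} {J} J⊆I = telltales⇒learnable (merge I) (converging J) λ {c} c∈𝔎 →
      [] , [] , λ b b∈𝔎 _ _ → ∼-trans (rep∼a {b} b∈𝔎) (∼-sym (rep∼a {c} c∈𝔎))
      where
      rep∼a : ∀ {c} → Member (converging J) (W c) → rep I c ∼ a
      rep∼a (inj₁ c≐a) = subst (rep I _ ∼_) (rep-unmerged a-unmerged) (rep-extends c≐a)
      rep∼a (inj₂ (n , n∈J , c≐D)) = ∼-reflexive (rep-merged (n , J⊆I n∈J , c≐D))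

    exhausts-list : ∀ {L} → All (W a) L → ∃[ n ] L ⊆ˡ D n
    exhausts-list [] = 0 , λ ()
    exhausts-list (x∈a ∷ L⊆a) =
      let m , x∈D = exhausts x∈a ; n , L⊆D = exhausts-list L⊆a
      in m ⊔ n , λ { (here refl) → mono (m≤m⊔n m n) x∈D
                   ; (there y∈L) → mono (m≤n⊔m m n) (L⊆D y∈L) }

    -- Any tell-tale of `a` is contained in some `D n` with `n` in `J` but not in `I`, and this set
    -- was left inequivalent to `a`.
    converging-unlearnable : ∀ {I J} → (∀ m → ∃[ n ] m ≤ n × J n × ¬ I n) →
      ¬ Learnable (merge I) (converging J)
    converging-unlearnable {I} {J} unbounded learnable =
      let L , L⊆a , close = learnable⇒telltales (merge I) (converging J) learnable {a} (inj₁ (id , id))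
          m , L⊆D = exhausts-list L⊆a
          n , m≤n , n∈J , n∉I = unbounded m
          n∼a = close (fin (D n)) (inj₂ (n , n∈J , W-fin (D n))) (∈-fin (mono m≤n ∘ L⊆D))
                  (fin⊆ (D⊆a n))
      in separated n (subst (fin (D n) ∼_) (rep-unmerged a-unmerged)
           (subst (_∼ rep I a) (rep-unmerged (D-unmerged n∉I)) n∼a))

    -- The embedding of finite sets of branches

    ι : List (ℕ → Bool) → Rᶜᵉ
    ι P = merge (branches P)

    ι-mono : ∀ {P Q} → (∀ {Y} → Y ∈² P → Y ∈² Q) → ι P ≤Learn ι Q
    ι-mono P⊆Q = merge-mono (branches-mono P⊆Q)

    ι-unlearnable : ∀ {Y} Q → Y ∉² Q → ¬ Learnable (ι Q) (converging (branch Y))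
    ι-unlearnable {Y} Q Y∉Q = converging-unlearnable {branches Q} {branch Y} λ m →
      let k₀ , disjoint = almost-disjoint Q Y∉Q
          -- The bound `m` makes the code large enough, and `k₀` takes it off all branches in `Q`.
          k = m ⊔ k₀
      in toℕ (prefix Y k) , ≤-trans (m≤m⊔n m k₀) (k≤prefix Y k) , (k , refl) ,
         disjoint k (m≤n⊔m m k₀)

    -- For `Y` in `P` but not in `Q`, the family along `branch Y` is learnable for `ι P` and not for
    -- `ι Q`.
    ι-cancel : ∀ {P Q} → ι P ≤Learn ι Q → ∀ {Y} → Y ∈² P → Y ∈² Q
    ι-cancel {P} {Q} (≤learn transfer) Y∈P = dne λ Y∉Q →
      ι-unlearnable Q Y∉Q (transfer (converging (branch _))
        (converging-learnable {branches P} (∈⇒branch⊆branches Y∈P)))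

    ι-¬universal : ∀ P → ¬ Universal (ι P)
    ι-¬universal P universal = ι-unlearnable P (diagonal∉ P) (universal (converging (branch (diagonal P))))

    rep-∅ : ∀ x → rep (branches []) x ≡ x
    rep-∅ x = rep-unmerged λ { (_ , () , _) }

    ι-∅ : Poset._≈_ TLH (ι []) E
    ι-∅ = coarser (λ {x} {y} → subst id (cong₂ _∼_ (rep-∅ x) (rep-∅ y))) ,
          coarser (λ {x} {y} → subst id (sym (cong₂ _∼_ (rep-∅ x) (rep-∅ y))))
      where
      coarser : ∀ {F G} → (∀ {x y} → Rᶜᵉ._∼_ F x y → Rᶜᵉ._∼_ G x y) → F ≤Learn G
      coarser F⊆G = ≤learn λ _ (M , converges) → M , λ e e∈𝔎 μ enumerates →
        let i , i∼e , conv = converges e e∈𝔎 μ enumerates in i , F⊆G i∼e , conv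

  -- The top element and coatoms

  learnable-Id₁ : ∀ 𝔎 → Learnable Id₁ 𝔎
  learnable-Id₁ 𝔎 = const 0 , λ _ _ _ _ → 0 , _ , 0 , λ _ _ → refl

  <Id₁⇔¬universal : ∀ E → E <Learn Id₁ ⇔ (¬ Universal E)
  <Id₁⇔¬universal E = mk⇔
    (λ (_ , Id₁≰E) universal → Id₁≰E (≤learn λ 𝔎 _ → universal 𝔎))
    (λ ¬universal → Id₁-maximum E , λ (≤learn transfer) →
      ¬universal λ 𝔎 → transfer 𝔎 (learnable-Id₁ 𝔎))

  ¬universal⇒<Id₁ : ∀ {E} → ¬ Universal E → _<_ TLH E Id₁
  ¬universal⇒<Id₁ {E} ¬universal = Id₁-maximum E ,
    λ E≈Id₁ → proj₂ (Equivalence.from (<Id₁⇔¬universal E) ¬universal) (rhs≤lhs E≈Id₁)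

  embedding : ∀ E → ¬ Universal E →
    Σ[ ι ∈ (List (ℕ → Bool) → Rᶜᵉ) ]
      IsOrderMonomorphism (Poset._≈_ (𝒫fin 2^ω)) (Poset._≈_ TLH)
                          (Poset._≤_ (𝒫fin 2^ω)) (Poset._≤_ TLH) ι ×
      Poset._≈_ TLH (ι []) E ×
      (∀ P → _<_ TLH (ι P) Id₁)
  embedding E ¬universal = ι ,
    record
      { isOrderHomomorphism = record
        { cong = λ (P⊆Q , Q⊆P) → ι-mono P⊆Q , ι-mono Q⊆P
        ; mono = λ P⊆Q → ι-mono P⊆Q
        }
      ; injective = λ (ιP≤ιQ , ιQ≤ιP) → ι-cancel ιP≤ιQ , ι-cancel ιQ≤ιP
      ; cancel    = λ ιP≤ιQ → ι-cancel ιP≤ιQ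
      } ,
    ι-∅ , λ P → ¬universal⇒<Id₁ (ι-¬universal P)
    where open Merging E (exhaustion E ¬universal)

  coatomless : Coatomless TLH Id₁ Id₁-maximum
  coatomless (E , (E≤Id₁ , E≉Id₁) , no-between) =
    let ι , ι-embeds , ι-∅ , ι<Id₁ = embedding E λ universal →
          E≉Id₁ (E≤Id₁ , ≤learn λ 𝔎 _ → universal 𝔎)
        open IsOrderMonomorphism ι-embeds
        -- Any sequence serves: the image of a singleton lies strictly between `E`, the image of the
        -- empty set, and the top.
        Y = const true
        E≤ιY = Poset.trans TLH (rhs≤lhs ι-∅) (mono {[]} {Y ∷ []} λ ())
    in no-between (ι (Y ∷ []) ,
         (E≤ιY , λ E≈ιY → case cancel {Y ∷ []} {[]}
             (Poset.trans TLH (rhs≤lhs E≈ιY) (rhs≤lhs ι-∅)) {Y} (here λ _ → refl) of λ ()) ,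
         ι<Id₁ (Y ∷ []))

theorem4p15 : Classical → (Φ : AcceptableEnumeration) →
    let open Learning Φ
        module 𝒫 = Poset (𝒫fin 2^ω)
        module ℰ = Poset TLH
    in
      (∀ (E : Rᶜᵉ) →
        (E <Learn Id₁ ⇔ (¬ Universal E)) ×
        (E <Learn Id₁ →
          Σ[ ι ∈ (𝒫.Carrier → ℰ.Carrier) ]
            IsOrderMonomorphism 𝒫._≈_ ℰ._≈_ 𝒫._≤_ ℰ._≤_ ι ×
            ι [] ℰ.≈ E ×
            (∀ P → _<_ TLH (ι P) Id₁)))
      × Coatomless TLH Id₁ Id₁-maximum
theorem4p15 classical Φ =
  (λ E → <Id₁⇔¬universal E , embedding E ∘ Equivalence.to (<Id₁⇔¬universal E)) , coatomless
  where open Hierarchy classical Φ
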